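{- Every $K_5$-free graph $G$ on $n$ vertices contains a triangle-free induced subgraph on at least $n^{5/12}/2$ vertices.
   Context: A graph is $K_5$-free if it contains no complete graph on $5$ vertices as a subgraph; it is triangle-free if it contains no $K_3$. -}

module Defs where

open import Data.Nat using (ℕ)
open import Data.Fin using (Fin)
open import Data.Fin.Subset using (Subset; _∈_)
open import Data.Product using (∃; _×_; _,_)
open import Data.Empty using (⊥)
open import Relation.Nullary using (¬_; Dec)
open import Relation.Binary.PropositionalEquality using (_≡_)
open import Function.Definitions using (Injective)
open import Level using (0ℓ)

record Graph (n : ℕ) : Set₁ where
  field
    Adj    : Fin n → Fin n → Set
    adj?   : ∀ u v → Dec (Adj u v)
    sym    : ∀ {u v} → Adj u v → Adj v u
    irrefl : ∀ {u} → ¬ Adj u u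
open Graph public

ContainsK : ∀ {n} → Graph n → ℕ → Set
ContainsK {n} G k =
  ∃ λ (f : Fin k → Fin n) →
    Injective _≡_ _≡_ f × (∀ i j → ¬ i ≡ j → Adj G (f i) (f j))

K5Free : ∀ {n} → Graph n → Set
K5Free G = ¬ ContainsK G 5

-- The subgraph induced on S is triangle-free: no three vertices of S
-- are pairwise adjacent (distinctness is automatic by irreflexivity).
InducedTriangleFree : ∀ {n} → Graph n → Subset n → Set
InducedTriangleFree G S =
  ∀ u v w → u ∈ S → v ∈ S → w ∈ S →
    Adj G u v → Adj G v w → Adj G u w → ⊥

{-# OPTIONS --safe #-}
-- Suppose that every triangle-free induced subgraph has at most s vertices,
-- where (2s)¹² < n⁵, and let D be the degree sum. The common neighbourhood of an
-- edge is triangle-free since G is K₅-free, so every edge lies in at most s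
-- triangles. Keeping each vertex with probability 2s / n and deleting the
-- vertices that still lie in triangles yields D ≥ n³ / (2s)³, so G is dense.
-- Then the common neighbourhood U of two random vertices has about D² / n³
-- vertices but few edges, because an edge survives in U with probability at most
-- (s / n)². Keeping each vertex of U with probability 2sn³ / D² and deleting the
-- non-isolated ones gives an independent set, hence D³ ≤ (2s)³ n⁴. Together
-- these two bounds contradict (2s)¹² < n⁵.
module Submission where

open import Defs
open import Data.Nat using (ℕ; _*_; _^_; _≤_)
open import Data.Fin.Subset using (Subset; ∣_∣)
open import Data.Product using (∃; _×_)

open import Data.Bool using (Bool; true; false; _∧_)
open import Data.Empty using (⊥-elim)
open import Data.Fin using (Fin; zero; suc)
import Data.Fin as Fin
import Data.Fin.Properties as Fin
open import Data.Fin.Subset using (_∈_; _∩_; ⁅_⁆)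
open import Data.Fin.Subset.Properties
  using (∣p∣≤n; ∣⁅x⁆∣≡1; x∈⁅y⁆⇒x≡y; _∈?_; anySubset?)
open import Data.Nat using (zero; suc; _+_; _<_; z≤n; s≤s; NonZero; _≡ᵇ_; >-nonZero; >-nonZero⁻¹)
open import Data.Nat.Properties
open import Data.Nat.Solver using (module +-*-Solver)
open import Data.Nat.Tactic.RingSolver using (solve-∀)
open import Data.Product using (_,_; proj₁; proj₂)
open import Data.Sum using (_⊎_; inj₁; inj₂)
open import Data.Vec using ([]; _∷_; lookup; tabulate; _[_]≔_)
open import Data.Vec.Functional using () renaming ([] to []ᶠ; _∷_ to _∷ᶠ_)
open import Data.Vec.Properties
  using ([]=⇒lookup; lookup∘tabulate; lookup∘update′; lookup-zipWith)
open import Function using (_∘_)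
open import Relation.Binary.PropositionalEquality
  using (_≡_; _≢_; refl; cong; cong₂; trans; subst; subst₂; module ≡-Reasoning)
  renaming (sym to ≡-sym)
open import Relation.Nullary using (¬_; Dec; yes; no; does; contradiction)
open import Relation.Nullary.Decidable using (_×-dec_; _→-dec_)

open import Algebra.Properties.Semiring.Sum +-*-semiring

private variable
  m n : ℕ

-- Indicators, finite sums and Cauchy-Schwarz.

⟦_⟧ : Bool → ℕ
⟦ true  ⟧ = 1
⟦ false ⟧ = 0

⟦∧⟧ : ∀ p q → ⟦ p ∧ q ⟧ ≡ ⟦ p ⟧ * ⟦ q ⟧
⟦∧⟧ true  q = ≡-sym (+-identityʳ ⟦ q ⟧)
⟦∧⟧ false q = refl

sum-mono-≤ : {f g : Fin n → ℕ} → (∀ i → f i ≤ g i) → sum f ≤ sum g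
sum-mono-≤ {zero}  f≤g = z≤n
sum-mono-≤ {suc n} f≤g = +-mono-≤ (f≤g zero) (sum-mono-≤ (f≤g ∘ suc))

sum-const : ∀ n k → ∑[ i < n ] k ≡ n * k
sum-const zero    k = refl
sum-const (suc n) k = cong (k +_) (sum-const n k)

sum-*-sum : (f : Fin m → ℕ) (g : Fin n → ℕ) →
            ∑[ i < m ] ∑[ j < n ] (f i * g j) ≡ sum f * sum g
sum-*-sum f g = trans
  (sum-cong-≗ λ i → ≡-sym (*-distribˡ-sum (f i) g))
  (≡-sym (*-distribʳ-sum (sum g) f))

∑-rotate : ∀ {l} (f : Fin l → Fin m → Fin n → ℕ) →
           ∑[ i < l ] ∑[ j < m ] ∑[ k < n ] f i j k ≡
           ∑[ k < n ] ∑[ i < l ] ∑[ j < m ] f i j k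
∑-rotate {l = l} f = trans
  (sum-cong-≗ λ i → ∑-comm (f i))
  (∑-comm λ i k → ∑[ j < _ ] f i j k)

2xy≤x²+y² : ∀ x y → 2 * (x * y) ≤ x * x + y * y
2xy≤x²+y² x y with ≤-total x y
... | inj₁ x≤y with k , refl ← m≤n⇒∃[o]m+o≡n x≤y =
  subst (2 * (x * (x + k)) ≤_) (lemma x k) (m≤m+n _ (k * k))
  where
  lemma : ∀ x k → 2 * (x * (x + k)) + k * k ≡ x * x + (x + k) * (x + k)
  lemma = solve-∀
... | inj₂ y≤x with k , refl ← m≤n⇒∃[o]m+o≡n y≤x =
  subst (2 * ((y + k) * y) ≤_) (lemma y k) (m≤m+n _ (k * k))
  where
  lemma : ∀ y k → 2 * ((y + k) * y) + k * k ≡ (y + k) * (y + k) + y * y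
  lemma = solve-∀

-- Summing `2xy≤x²+y²` over all pairs `f i`, `f j` gives twice the claim.
cauchy-schwarz : (f : Fin n → ℕ) → sum f * sum f ≤ n * ∑[ i < n ] (f i * f i)
cauchy-schwarz {n} f = *-cancelˡ-≤ 2 (begin
  2 * (sum f * sum f)
    ≡⟨ cong (2 *_) (sum-*-sum f f) ⟨
  2 * ∑[ i < n ] ∑[ j < n ] (f i * f j)
    ≡⟨ *-distribˡ-sum 2 (λ i → ∑[ j < n ] (f i * f j)) ⟩
  ∑[ i < n ] (2 * ∑[ j < n ] (f i * f j))
    ≤⟨ sum-mono-≤ row ⟩
  ∑[ i < n ] (n * (f i * f i) + Q)
    ≡⟨ ∑-distrib-+ (λ i → n * (f i * f i)) (λ _ → Q) ⟩
  ∑[ i < n ] (n * (f i * f i)) + ∑[ i < n ] Q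
    ≡⟨ cong₂ _+_ (≡-sym (*-distribˡ-sum n (λ i → f i * f i))) (sum-const n Q) ⟩
  n * Q + n * Q
    ≡⟨ cong (n * Q +_) (+-identityʳ _) ⟨
  2 * (n * Q) ∎)
  where
  open ≤-Reasoning
  Q = ∑[ i < n ] (f i * f i)
  row : ∀ i → 2 * ∑[ j < n ] (f i * f j) ≤ n * (f i * f i) + Q
  row i = begin
    2 * ∑[ j < n ] (f i * f j)
      ≡⟨ *-distribˡ-sum 2 (λ j → f i * f j) ⟩
    ∑[ j < n ] (2 * (f i * f j))
      ≤⟨ sum-mono-≤ (λ j → 2xy≤x²+y² (f i) (f j)) ⟩
    ∑[ j < n ] (f i * f i + f j * f j)
      ≡⟨ ∑-distrib-+ (λ _ → f i * f i) (λ j → f j * f j) ⟩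
    ∑[ j < n ] (f i * f i) + Q
      ≡⟨ cong (_+ Q) (sum-const n _) ⟩
    n * (f i * f i) + Q ∎

-- Subsets as 0/1 vectors.

χ : Subset n → Fin n → ℕ
χ S i = ⟦ lookup S i ⟧

∣∣≡sum-χ : (S : Subset n) → ∣ S ∣ ≡ sum (χ S)
∣∣≡sum-χ []          = refl
∣∣≡sum-χ (true  ∷ S) = cong suc (∣∣≡sum-χ S)
∣∣≡sum-χ (false ∷ S) = ∣∣≡sum-χ S

χ-tabulate : ∀ (f : Fin n → Bool) i → χ (tabulate f) i ≡ ⟦ f i ⟧
χ-tabulate f i = cong ⟦_⟧ (lookup∘tabulate f i)

χ-∩ : ∀ (S T : Subset n) i → χ (S ∩ T) i ≡ χ S i * χ T i
χ-∩ S T i = trans (cong ⟦_⟧ (lookup-zipWith _∧_ i S T)) (⟦∧⟧ (lookup S i) (lookup T i))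

∈-tabulate⁻ : ∀ {f : Fin n → Bool} {i} → i ∈ tabulate f → f i ≡ true
∈-tabulate⁻ {f = f} {i} i∈ = trans (≡-sym (lookup∘tabulate f i)) ([]=⇒lookup i∈)

term≤sum : ∀ (f : Fin n → ℕ) i → f i ≤ sum f
term≤sum f zero    = m≤m+n _ _
term≤sum f (suc i) = ≤-trans (term≤sum (f ∘ suc) i) (m≤n+m _ _)

-- Moments of random subsets.

-- Unnormalised expectation over random subsets containing each point
-- independently with probability a / (a + c).
module Expectation (a c : ℕ) where

  b : ℕ
  b = a + c

  -- Weights replace probabilities so that all values stay in ℕ; the true expectation is the
  -- quotient by the total mass `b ^ n`.
  E : (Subset n → ℕ) → ℕ
  E {zero}  f = f []
  E {suc n} f = a * E (f ∘ (true ∷_)) + c * E (f ∘ (false ∷_))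

  E-mono : {f g : Subset n → ℕ} → (∀ S → f S ≤ g S) → E f ≤ E g
  E-mono {zero}  f≤g = f≤g []
  E-mono {suc n} f≤g = +-mono-≤ (*-monoʳ-≤ a (E-mono (f≤g ∘ (true ∷_))))
                                (*-monoʳ-≤ c (E-mono (f≤g ∘ (false ∷_))))

  E-cong : {f g : Subset n → ℕ} → (∀ S → f S ≡ g S) → E f ≡ E g
  E-cong f≡g = ≤-antisym (E-mono (≤-reflexive ∘ f≡g)) (E-mono (≤-reflexive ∘ ≡-sym ∘ f≡g))

  E-const : ∀ n k → E {n} (λ _ → k) ≡ k * b ^ n
  E-const zero    k = ≡-sym (*-identityʳ k)
  E-const (suc n) k rewrite E-const n k = lemma a c k (b ^ n)
    where
    lemma : ∀ a c k m → a * (k * m) + c * (k * m) ≡ k * ((a + c) * m)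
    lemma = solve-∀

  E-+ : (f g : Subset n → ℕ) → E (λ S → f S + g S) ≡ E f + E g
  E-+ {zero}  f g = refl
  E-+ {suc n} f g
    rewrite E-+ (f ∘ (true ∷_)) (g ∘ (true ∷_)) | E-+ (f ∘ (false ∷_)) (g ∘ (false ∷_)) =
    lemma a c _ _ _ _
    where
    lemma : ∀ a c p q r s → a * (p + q) + c * (r + s) ≡ a * p + c * r + (a * q + c * s)
    lemma = solve-∀

  E-sum : (f : Fin m → Subset n → ℕ) → E (λ S → ∑[ i < m ] f i S) ≡ ∑[ i < m ] E (f i)
  E-sum {zero}  {n} f = E-const n 0
  E-sum {suc m} f = trans (E-+ (f zero) _) (cong (E (f zero) +_) (E-sum (f ∘ suc)))

  -- Since `f` has the same value with or without the point `i`, the sets containing `i` carry the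
  -- share `a` out of `b = a + c`. The induction walks to the position of `i`.
  E-χ-independent : ∀ (i : Fin n) (f : Subset n → ℕ) → (∀ S x → f (S [ i ]≔ x) ≡ f S) →
                    b * E (λ S → χ S i * f S) ≡ a * E f
  E-χ-independent {suc n} zero f indep = begin
    b * (a * E (λ S → 1 * f (true ∷ S)) + c * E {n} (λ _ → 0))
      ≡⟨ cong₂ (λ p q → b * (a * p + c * q)) (E-cong λ S → *-identityˡ (f (true ∷ S))) (E-const n 0) ⟩
    b * (a * E (f ∘ (true ∷_)) + c * 0)
      ≡⟨ lemma a c _ ⟩
    a * (a * E (f ∘ (true ∷_)) + c * E (f ∘ (true ∷_)))
      ≡⟨ cong (λ p → a * (a * E (f ∘ (true ∷_)) + c * p)) (E-cong λ S → indep (false ∷ S) true) ⟩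
    a * (a * E (f ∘ (true ∷_)) + c * E (f ∘ (false ∷_))) ∎
    where
    open ≡-Reasoning
    lemma : ∀ a c p → (a + c) * (a * p + c * 0) ≡ a * (a * p + c * p)
    lemma = solve-∀
  E-χ-independent {suc n} (suc i) f indep = begin
    b * (a * P + c * Q)        ≡⟨ lemma₁ b a c P Q ⟩
    a * (b * P) + c * (b * Q)  ≡⟨ cong₂ (λ p q → a * p + c * q)
                                    (E-χ-independent i _ (indep ∘ (true ∷_)))
                                    (E-χ-independent i _ (indep ∘ (false ∷_))) ⟩
    a * (a * _) + c * (a * _)  ≡⟨ lemma₂ a c _ _ ⟩
    a * E f                    ∎
    where
    open ≡-Reasoning
    P = E (λ S → χ S i * f (true ∷ S))
    Q = E (λ S → χ S i * f (false ∷ S))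
    lemma₁ : ∀ b a c P Q → b * (a * P + c * Q) ≡ a * (b * P) + c * (b * Q)
    lemma₁ = solve-∀
    lemma₂ : ∀ a c P Q → a * (a * P) + c * (a * Q) ≡ a * (a * P + c * Q)
    lemma₂ = solve-∀

  χ-update : ∀ {i j : Fin n} → i ≢ j → ∀ S x → χ (S [ i ]≔ x) j ≡ χ S j
  χ-update i≢j S x = cong ⟦_⟧ (lookup∘update′ (i≢j ∘ ≡-sym) S x)

  moment₁ : ∀ (i : Fin n) k → b * E (λ S → χ S i * k) ≡ a * (k * b ^ n)
  moment₁ {n} i k = trans (E-χ-independent i _ (λ _ _ → refl)) (cong (a *_) (E-const n k))

  -- Because `i ≢ j`, the factor `χ S j` ignores the point `i`, so the two points split off one
  -- after the other, each at the price `a / b`.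
  moment₂ : ∀ {i j : Fin n} k → i ≢ j →
            b * (b * E (λ S → χ S i * (χ S j * k))) ≡ a * (a * (k * b ^ n))
  moment₂ {n} {i} {j} k i≢j = begin
    b * (b * E (λ S → χ S i * (χ S j * k)))
      ≡⟨ cong (b *_) (E-χ-independent i _ λ S x → cong (_* k) (χ-update i≢j S x)) ⟩
    b * (a * E (λ S → χ S j * k))  ≡⟨ x∙yz≈y∙xz b a _ ⟩
    a * (b * E (λ S → χ S j * k))  ≡⟨ cong (a *_) (moment₁ j k) ⟩
    a * (a * (k * b ^ n))          ∎
    where
    open ≡-Reasoning
    open import Algebra.Properties.CommutativeSemigroup *-commutativeSemigroup

  moment₃ : ∀ {h i j : Fin n} k → h ≢ i → h ≢ j → i ≢ j →
            b * (b * (b * E (λ S → χ S h * (χ S i * (χ S j * k))))) ≡ a * (a * (a * (k * b ^ n)))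
  moment₃ {n} {h} {i} {j} k h≢i h≢j i≢j = begin
    b * (b * (b * E (λ S → χ S h * (χ S i * (χ S j * k)))))
      ≡⟨ cong (λ p → b * (b * p)) (E-χ-independent h _ λ S x →
           cong₂ (λ p q → p * (q * k)) (χ-update h≢i S x) (χ-update h≢j S x)) ⟩
    b * (b * (a * E (λ S → χ S i * (χ S j * k))))  ≡⟨ lemma b a _ ⟩
    a * (b * (b * E (λ S → χ S i * (χ S j * k))))  ≡⟨ cong (a *_) (moment₂ k i≢j) ⟩
    a * (a * (a * (k * b ^ n)))                    ∎
    where
    open ≡-Reasoning
    lemma : ∀ b a p → b * (b * (a * p)) ≡ a * (b * (b * p))
    lemma = solve-∀

  E-vanishing : (f : Subset n → ℕ) → (∀ S → f S ≡ 0) → E f ≡ 0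
  E-vanishing {n} f f≡0 = trans (E-cong f≡0) (E-const n 0)

  E-linear : ∀ (f : Fin n → ℕ) → b * E (λ S → ∑[ i < n ] (χ S i * f i)) ≡ a * sum f * b ^ n
  E-linear {n} f = begin
    b * E (λ S → ∑[ i < n ] (χ S i * f i))    ≡⟨ cong (b *_) (E-sum λ i S → χ S i * f i) ⟩
    b * ∑[ i < n ] E (λ S → χ S i * f i)      ≡⟨ *-distribˡ-sum b (λ i → E (λ S → χ S i * f i)) ⟩
    ∑[ i < n ] (b * E (λ S → χ S i * f i))    ≡⟨ sum-cong-≗ (λ i → trans (moment₁ i (f i)) (≡-sym (*-assoc a (f i) _))) ⟩
    ∑[ i < n ] (a * f i * b ^ n)              ≡⟨ *-distribʳ-sum (b ^ n) (λ i → a * f i) ⟨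
    ∑[ i < n ] (a * f i) * b ^ n              ≡⟨ cong (_* b ^ n) (*-distribˡ-sum a f) ⟨
    a * sum f * b ^ n                         ∎
    where open ≡-Reasoning

  -- Off the diagonal each term has weight (a / b)². On it `χ S i * χ S i` collapses to `χ S i`, of
  -- weight a / b only, so `off` makes those coefficients vanish.
  E-quadratic : ∀ (g : Fin n → Fin n → ℕ) → (∀ i j → g i j ≡ 0 ⊎ i ≢ j) →
    b * b * E (λ S → ∑[ i < n ] ∑[ j < n ] (χ S i * (χ S j * g i j)))
      ≡ a * a * ∑[ i < n ] ∑[ j < n ] g i j * b ^ n
  E-quadratic {n} g off = begin
    b * b * E (λ S → ∑[ i < n ] ∑[ j < n ] M i j S)
      ≡⟨ cong (b * b *_) (trans (E-sum λ i S → ∑[ j < n ] M i j S) (sum-cong-≗ λ i → E-sum (M i))) ⟩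
    b * b * ∑[ i < n ] ∑[ j < n ] E (M i j)
      ≡⟨ pull (b * b) _ ⟩
    ∑[ i < n ] ∑[ j < n ] (b * b * E (M i j))
      ≡⟨ sum-cong-≗ (λ i → sum-cong-≗ λ j → term i j (off i j)) ⟩
    ∑[ i < n ] ∑[ j < n ] (a * a * b ^ n * g i j)
      ≡⟨ pull (a * a * b ^ n) g ⟨
    a * a * b ^ n * ∑[ i < n ] ∑[ j < n ] g i j
      ≡⟨ xy∙z≈xz∙y (a * a) _ _ ⟩
    a * a * ∑[ i < n ] ∑[ j < n ] g i j * b ^ n ∎
    where
    open ≡-Reasoning
    open import Algebra.Properties.CommutativeSemigroup *-commutativeSemigroup
    M : Fin n → Fin n → Subset n → ℕ
    M i j S = χ S i * (χ S j * g i j)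
    pull : ∀ k (f : Fin n → Fin n → ℕ) →
           k * ∑[ i < n ] ∑[ j < n ] f i j ≡ ∑[ i < n ] ∑[ j < n ] (k * f i j)
    pull k f = trans (*-distribˡ-sum k (λ i → ∑[ j < n ] f i j)) (sum-cong-≗ λ i → *-distribˡ-sum k (f i))
    term : ∀ i j → g i j ≡ 0 ⊎ i ≢ j → b * b * E (M i j) ≡ a * a * b ^ n * g i j
    term i j (inj₁ g≡0) = begin
      b * b * E (M i j)      ≡⟨ cong (b * b *_) (E-vanishing (M i j) zeroM) ⟩
      b * b * 0              ≡⟨ *-zeroʳ (b * b) ⟩
      0                      ≡⟨ *-zeroʳ (a * a * b ^ n) ⟨
      a * a * b ^ n * 0      ≡⟨ cong (a * a * b ^ n *_) g≡0 ⟨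
      a * a * b ^ n * g i j  ∎
      where
      zeroM : ∀ S → M i j S ≡ 0
      zeroM S rewrite g≡0 | *-zeroʳ (χ S j) = *-zeroʳ (χ S i)
    term i j (inj₂ i≢j) =
      trans (*-assoc b b _) (trans (moment₂ (g i j) i≢j) (lemma a (g i j) (b ^ n)))
      where
      lemma : ∀ a k m → a * (a * (k * m)) ≡ a * a * m * k
      lemma = solve-∀

  E-cubic : ∀ (g : Fin n → Fin n → Fin n → ℕ) →
    (∀ h i j → g h i j ≡ 0 ⊎ (h ≢ i × h ≢ j × i ≢ j)) →
    b * b * b * E (λ S → ∑[ h < n ] ∑[ i < n ] ∑[ j < n ] (χ S h * (χ S i * (χ S j * g h i j))))
      ≡ a * a * a * ∑[ h < n ] ∑[ i < n ] ∑[ j < n ] g h i j * b ^ n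
  E-cubic {n} g off = begin
    b * b * b * E (λ S → ∑[ h < n ] ∑[ i < n ] ∑[ j < n ] M h i j S)
      ≡⟨ cong (b * b * b *_)
           (trans (E-sum λ h S → ∑[ i < n ] ∑[ j < n ] M h i j S) (sum-cong-≗ λ h →
            trans (E-sum λ i S → ∑[ j < n ] M h i j S) (sum-cong-≗ λ i → E-sum (M h i)))) ⟩
    b * b * b * ∑[ h < n ] ∑[ i < n ] ∑[ j < n ] E (M h i j)
      ≡⟨ pull (b * b * b) _ ⟩
    ∑[ h < n ] ∑[ i < n ] ∑[ j < n ] (b * b * b * E (M h i j))
      ≡⟨ sum-cong-≗ (λ h → sum-cong-≗ λ i → sum-cong-≗ λ j → term h i j (off h i j)) ⟩
    ∑[ h < n ] ∑[ i < n ] ∑[ j < n ] (a * a * a * b ^ n * g h i j)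
      ≡⟨ pull (a * a * a * b ^ n) g ⟨
    a * a * a * b ^ n * ∑[ h < n ] ∑[ i < n ] ∑[ j < n ] g h i j
      ≡⟨ xy∙z≈xz∙y (a * a * a) _ _ ⟩
    a * a * a * ∑[ h < n ] ∑[ i < n ] ∑[ j < n ] g h i j * b ^ n ∎
    where
    open ≡-Reasoning
    open import Algebra.Properties.CommutativeSemigroup *-commutativeSemigroup
    M : Fin n → Fin n → Fin n → Subset n → ℕ
    M h i j S = χ S h * (χ S i * (χ S j * g h i j))
    pull : ∀ k (f : Fin n → Fin n → Fin n → ℕ) →
           k * ∑[ h < n ] ∑[ i < n ] ∑[ j < n ] f h i j ≡
           ∑[ h < n ] ∑[ i < n ] ∑[ j < n ] (k * f h i j)
    pull k f = trans (*-distribˡ-sum k (λ h → ∑[ i < n ] ∑[ j < n ] f h i j)) (sum-cong-≗ λ h →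
               trans (*-distribˡ-sum k (λ i → ∑[ j < n ] f h i j)) (sum-cong-≗ λ i → *-distribˡ-sum k (f h i)))
    term : ∀ h i j → g h i j ≡ 0 ⊎ (h ≢ i × h ≢ j × i ≢ j) →
           b * b * b * E (M h i j) ≡ a * a * a * b ^ n * g h i j
    term h i j (inj₁ g≡0) = begin
      b * b * b * E (M h i j)      ≡⟨ cong (b * b * b *_) (E-vanishing (M h i j) zeroM) ⟩
      b * b * b * 0                ≡⟨ *-zeroʳ (b * b * b) ⟩
      0                            ≡⟨ *-zeroʳ (a * a * a * b ^ n) ⟨
      a * a * a * b ^ n * 0        ≡⟨ cong (a * a * a * b ^ n *_) g≡0 ⟨
      a * a * a * b ^ n * g h i j  ∎
      where
      zeroM : ∀ S → M h i j S ≡ 0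
      zeroM S rewrite g≡0 | *-zeroʳ (χ S j) | *-zeroʳ (χ S i) = *-zeroʳ (χ S h)
    term h i j (inj₂ (h≢i , h≢j , i≢j)) =
      trans (lemma₁ b _) (trans (moment₃ (g h i j) h≢i h≢j i≢j) (lemma₂ a (g h i j) (b ^ n)))
      where
      lemma₁ : ∀ b p → b * b * b * p ≡ b * (b * (b * p))
      lemma₁ = solve-∀
      lemma₂ : ∀ a k m → a * (a * (a * (k * m))) ≡ a * a * a * m * k
      lemma₂ = solve-∀

-- From inequalities for every subset to averages.

-- If p(x) ≤ s + q(x) on all 0/1 vectors x, where p is linear and q is
-- multilinear of degree 2 (or 3), then this also holds at x = (a/b , … , a/b).
sample₂ : ∀ {a b} .{{_ : NonZero b}} → a ≤ b → ∀ s (f : Fin n → ℕ) (g : Fin n → Fin n → ℕ) →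
  (∀ i j → g i j ≡ 0 ⊎ i ≢ j) →
  (∀ S → ∑[ i < n ] (χ S i * f i) ≤ s + ∑[ i < n ] ∑[ j < n ] (χ S i * (χ S j * g i j))) →
  a * b * sum f ≤ b * b * s + a * a * ∑[ i < n ] ∑[ j < n ] g i j
-- `c` is `b - a`, the weight of absence, so the sampling probability is a / b.
sample₂ {n} {a} a≤b s f g off bound with c , refl ← m≤n⇒∃[o]m+o≡n a≤b =
  *-cancelʳ-≤ _ _ (b ^ n) {{m^n≢0 b n}} (begin
  a * b * sum f * b ^ n
    ≡⟨ lemma a b (sum f) (b ^ n) ⟩
  b * (a * sum f * b ^ n)
    ≡⟨ cong (b *_) (E-linear f) ⟨
  b * (b * E (λ S → ∑[ i < n ] (χ S i * f i)))
    ≤⟨ *-monoʳ-≤ b (*-monoʳ-≤ b (E-mono bound)) ⟩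
  b * (b * E (λ S → s + Q S))
    ≡⟨ *-assoc b b _ ⟨
  b * b * E (λ S → s + Q S)
    ≡⟨ cong (b * b *_) (E-+ (λ _ → s) Q) ⟩
  b * b * (E {n} (λ _ → s) + E Q)
    ≡⟨ *-distribˡ-+ (b * b) (E {n} (λ _ → s)) (E Q) ⟩
  b * b * E {n} (λ _ → s) + b * b * E Q
    ≡⟨ cong₂ (λ p q → b * b * p + q) (E-const n s) (E-quadratic g off) ⟩
  b * b * (s * b ^ n) + a * a * G * b ^ n
    ≡⟨ cong (_+ a * a * G * b ^ n) (*-assoc (b * b) s (b ^ n)) ⟨
  b * b * s * b ^ n + a * a * G * b ^ n
    ≡⟨ *-distribʳ-+ (b ^ n) (b * b * s) (a * a * G) ⟨
  (b * b * s + a * a * G) * b ^ n ∎)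
  where
  open ≤-Reasoning
  open Expectation a c
  Q : Subset n → ℕ
  Q S = ∑[ i < n ] ∑[ j < n ] (χ S i * (χ S j * g i j))
  G = ∑[ i < n ] ∑[ j < n ] g i j
  lemma : ∀ a b p m → a * b * p * m ≡ b * (a * p * m)
  lemma = solve-∀

sample₃ : ∀ {a b} .{{_ : NonZero b}} → a ≤ b →
  ∀ s (f : Fin n → ℕ) (g : Fin n → Fin n → Fin n → ℕ) →
  (∀ h i j → g h i j ≡ 0 ⊎ (h ≢ i × h ≢ j × i ≢ j)) →
  (∀ S → ∑[ i < n ] (χ S i * f i) ≤
         s + ∑[ h < n ] ∑[ i < n ] ∑[ j < n ] (χ S h * (χ S i * (χ S j * g h i j)))) →
  a * (b * b) * sum f ≤ b * b * b * s + a * a * a * ∑[ h < n ] ∑[ i < n ] ∑[ j < n ] g h i j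
sample₃ {n} {a} a≤b s f g off bound with c , refl ← m≤n⇒∃[o]m+o≡n a≤b =
  *-cancelʳ-≤ _ _ (b ^ n) {{m^n≢0 b n}} (begin
  a * (b * b) * sum f * b ^ n
    ≡⟨ lemma a b (sum f) (b ^ n) ⟩
  b * b * (a * sum f * b ^ n)
    ≡⟨ cong (b * b *_) (E-linear f) ⟨
  b * b * (b * E (λ S → ∑[ i < n ] (χ S i * f i)))
    ≤⟨ *-monoʳ-≤ (b * b) (*-monoʳ-≤ b (E-mono bound)) ⟩
  b * b * (b * E (λ S → s + Q S))
    ≡⟨ *-assoc (b * b) b _ ⟨
  b * b * b * E (λ S → s + Q S)
    ≡⟨ cong (b * b * b *_) (E-+ (λ _ → s) Q) ⟩
  b * b * b * (E {n} (λ _ → s) + E Q)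
    ≡⟨ *-distribˡ-+ (b * b * b) (E {n} (λ _ → s)) (E Q) ⟩
  b * b * b * E {n} (λ _ → s) + b * b * b * E Q
    ≡⟨ cong₂ (λ p q → b * b * b * p + q) (E-const n s) (E-cubic g off) ⟩
  b * b * b * (s * b ^ n) + a * a * a * G * b ^ n
    ≡⟨ cong (_+ a * a * a * G * b ^ n) (*-assoc (b * b * b) s (b ^ n)) ⟨
  b * b * b * s * b ^ n + a * a * a * G * b ^ n
    ≡⟨ *-distribʳ-+ (b ^ n) (b * b * b * s) (a * a * a * G) ⟨
  (b * b * b * s + a * a * a * G) * b ^ n ∎)
  where
  open ≤-Reasoning
  open Expectation a c
  Q : Subset n → ℕ
  Q S = ∑[ h < n ] ∑[ i < n ] ∑[ j < n ] (χ S h * (χ S i * (χ S j * g h i j)))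
  G = ∑[ h < n ] ∑[ i < n ] ∑[ j < n ] g h i j
  lemma : ∀ a b p m → a * (b * b) * p * m ≡ b * b * (a * p * m)
  lemma = solve-∀

-- The deletion step of the alteration method.

zerosIn : Subset n → (Fin n → ℕ) → Subset n
zerosIn S h = tabulate λ i → lookup S i ∧ (h i ≡ᵇ 0)

-- A dropped point has `h i` at least 1 and so pays for itself in the sum. In the applications `h i`
-- counts forbidden configurations through `i`.
∣∣≤∣zerosIn∣+sum : (S : Subset n) (h : Fin n → ℕ) →
                   ∣ S ∣ ≤ ∣ zerosIn S h ∣ + ∑[ i < n ] (χ S i * h i)
∣∣≤∣zerosIn∣+sum {n} S h = begin
  ∣ S ∣
    ≡⟨ ∣∣≡sum-χ S ⟩
  sum (χ S)
    ≤⟨ sum-mono-≤ (λ i → pointwise (lookup S i) (h i)) ⟩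
  ∑[ i < n ] (⟦ z i ⟧ + χ S i * h i)
    ≡⟨ ∑-distrib-+ (λ i → ⟦ z i ⟧) (λ i → χ S i * h i) ⟩
  ∑[ i < n ] ⟦ z i ⟧ + R
    ≡⟨ cong (_+ R) (sum-cong-≗ (χ-tabulate z)) ⟨
  sum (χ (zerosIn S h)) + R
    ≡⟨ cong (_+ R) (∣∣≡sum-χ (zerosIn S h)) ⟨
  ∣ zerosIn S h ∣ + R ∎
  where
  open ≤-Reasoning
  z : Fin n → Bool
  z i = lookup S i ∧ (h i ≡ᵇ 0)
  R = ∑[ i < n ] (χ S i * h i)
  pointwise : ∀ x k → ⟦ x ⟧ ≤ ⟦ x ∧ (k ≡ᵇ 0) ⟧ + ⟦ x ⟧ * k
  pointwise true  zero    = ≤-refl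
  pointwise true  (suc k) = s≤s z≤n
  pointwise false k       = z≤n

∈-zerosIn⁻ : ∀ (S : Subset n) h {i} → i ∈ zerosIn S h → χ S i ≡ 1 × h i ≡ 0
∈-zerosIn⁻ S h {i} i∈ = split (lookup S i) (h i) (∈-tabulate⁻ i∈)
  where
  split : ∀ x k → x ∧ (k ≡ᵇ 0) ≡ true → ⟦ x ⟧ ≡ 1 × k ≡ 0
  split true zero _ = refl , refl

-- Adjacency counts and cliques.

module _ (G : Graph n) where

  A : Fin n → Fin n → ℕ
  A u v = ⟦ does (adj? G u v) ⟧

  A-adj : ∀ {u v} → Adj G u v → A u v ≡ 1
  A-adj {u} {v} uv with adj? G u v
  ... | yes _  = refl
  ... | no ¬uv = contradiction uv ¬uv

  -- The disjunction has the form that `sample₂` asks of its coefficients.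
  A-distinct : ∀ u v → A u v ≡ 0 ⊎ u ≢ v
  A-distinct u v with adj? G u v
  ... | yes uv = inj₂ λ { refl → irrefl G uv }
  ... | no _   = inj₁ refl

  Independent : Subset n → Set
  Independent S = ∀ u v → u ∈ S → v ∈ S → ¬ Adj G u v

  independent⇒triangleFree : ∀ {S} → Independent S → InducedTriangleFree G S
  independent⇒triangleFree ind u v w u∈ v∈ _ uv _ _ = ind u v u∈ v∈ uv

  -- Decidability permits a search through all subsets, which turns the final refutation into a
  -- witness.
  triangleFree? : ∀ S → Dec (InducedTriangleFree G S)
  triangleFree? S = Fin.all? λ u → Fin.all? λ v → Fin.all? λ w →
    (u ∈? S) →-dec (v ∈? S) →-dec (w ∈? S) →-dec
    adj? G u v →-dec adj? G v w →-dec adj? G u w →-dec no λ ()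

  deg : Fin n → ℕ
  deg v = ∑[ w < n ] A w v

  codeg : Fin n → Fin n → ℕ
  codeg u v = ∑[ w < n ] (A w u * A w v)

  degreeSum : ℕ
  degreeSum = sum deg

  commonNeighbours : Fin n → Fin n → Subset n
  commonNeighbours u v = tabulate λ w → does (adj? G w u) ∧ does (adj? G w v)

  χ-commonNeighbours : ∀ u v w → χ (commonNeighbours u v) w ≡ A w u * A w v
  χ-commonNeighbours u v w = trans (χ-tabulate _ w) (⟦∧⟧ (does (adj? G w u)) _)

  ∣commonNeighbours∣ : ∀ u v → ∣ commonNeighbours u v ∣ ≡ codeg u v
  ∣commonNeighbours∣ u v =
    trans (∣∣≡sum-χ (commonNeighbours u v)) (sum-cong-≗ (χ-commonNeighbours u v))

  ∈-commonNeighbours⁻ : ∀ {u v w} → w ∈ commonNeighbours u v → Adj G w u × Adj G w v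
  ∈-commonNeighbours⁻ {u} {v} {w} w∈ with adj? G w u | adj? G w v | ∈-tabulate⁻ w∈
  ... | yes wu | yes wv | _ = wu , wv

  Clique : ∀ {k} → (Fin k → Fin n) → Set
  Clique f = ∀ i j → ¬ i ≡ j → Adj G (f i) (f j)

  clique-∷ : ∀ {k x} {f : Fin k → Fin n} → (∀ i → Adj G x (f i)) → Clique f → Clique (x ∷ᶠ f)
  clique-∷ x~f cl zero    zero    i≢j = contradiction refl i≢j
  clique-∷ x~f cl zero    (suc j) _   = x~f j
  clique-∷ x~f cl (suc i) zero    _   = sym G (x~f i)
  clique-∷ x~f cl (suc i) (suc j) i≢j = cl i j (i≢j ∘ cong suc)

  -- Injectivity comes from irreflexivity: distinct indices with equal images would give a loop.
  clique⇒containsK : ∀ {k} {f : Fin k → Fin n} → Clique f → ContainsK G k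
  clique⇒containsK {f = f} cl = f , inj , cl
    where
    inj : ∀ {i j} → f i ≡ f j → i ≡ j
    inj {i} {j} fi≡fj with i Fin.≟ j
    ... | yes i≡j = i≡j
    ... | no  i≢j = ⊥-elim (irrefl G (subst (Adj G (f i)) (≡-sym fi≡fj) (cl i j i≢j)))

  -- A triangle `u`, `v`, `w` among the common neighbours would complete the edge `x y` to a K₅.
  commonNeighbours-triangleFree : K5Free G → ∀ {x y} → Adj G x y →
                                  InducedTriangleFree G (commonNeighbours x y)
  commonNeighbours-triangleFree K5free {x} {y} xy u v w u∈ v∈ w∈ uv vw uw
    with ux , uy ← ∈-commonNeighbours⁻ u∈
       | vx , vy ← ∈-commonNeighbours⁻ v∈
       | wx , wy ← ∈-commonNeighbours⁻ w∈ =
    K5free (clique⇒containsK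
      (clique-∷ {f = v ∷ᶠ w ∷ᶠ x ∷ᶠ y ∷ᶠ []ᶠ}
                (λ { zero → uv ; (suc zero) → uw ; (suc (suc zero)) → ux ; (suc (suc (suc zero))) → uy })
      (clique-∷ {f = w ∷ᶠ x ∷ᶠ y ∷ᶠ []ᶠ} (λ { zero → vw ; (suc zero) → vx ; (suc (suc zero)) → vy })
      (clique-∷ {f = x ∷ᶠ y ∷ᶠ []ᶠ} (λ { zero → wx ; (suc zero) → wy })
      (clique-∷ {f = y ∷ᶠ []ᶠ} (λ { zero → xy })
      (clique-∷ {f = []ᶠ} (λ ()) λ ()))))))

  -- Consequences of a bound on all triangle-free sets.

  module _ (K5free : K5Free G) {s : ℕ} (≤s : ∀ S → InducedTriangleFree G S → ∣ S ∣ ≤ s) where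

    -- The factor `A x y` restricts the claim to edges, whose common neighbourhoods are
    -- triangle-free.
    codeg-bound : ∀ x y → A x y * codeg x y ≤ A x y * s
    codeg-bound x y with adj? G x y
    ... | no  _  = z≤n
    ... | yes xy = *-monoʳ-≤ 1 (subst (_≤ s) (∣commonNeighbours∣ x y)
                     (≤s _ (commonNeighbours-triangleFree K5free xy)))

    -- Deleting each vertex of `S` with a neighbour in `S` leaves an independent set, which is
    -- triangle-free; the sum pays for the deleted vertices.
    independent-bound : (S : Subset n) →
      ∣ S ∣ ≤ s + ∑[ u < n ] (χ S u * ∑[ v < n ] (χ S v * A u v))
    independent-bound S = ≤-trans (∣∣≤∣zerosIn∣+sum S h)
      (+-monoˡ-≤ _ (≤s (zerosIn S h) (independent⇒triangleFree ind)))
      where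
      h : Fin n → ℕ
      h u = ∑[ v < n ] (χ S v * A u v)
      ind : Independent (zerosIn S h)
      ind u v u∈ v∈ uv = contradiction
        (subst₂ (λ p q → p * q ≤ 0) (proj₁ (∈-zerosIn⁻ S h v∈)) (A-adj uv)
          (≤-trans (term≤sum (λ v → χ S v * A u v) v) (≤-reflexive (proj₂ (∈-zerosIn⁻ S h u∈)))))
        λ ()

    -- Few triangles force many edges.

    T : Fin n → Fin n → Fin n → ℕ
    T u v w = A u v * (A w u * A w v)

    T-distinct : ∀ u v w → T u v w ≡ 0 ⊎ (u ≢ v × u ≢ w × v ≢ w)
    T-distinct u v w with A-distinct u v | A-distinct w u | A-distinct w v
    ... | inj₁ uv≡0 | _ | _ rewrite uv≡0 = inj₁ refl
    ... | inj₂ _ | inj₁ wu≡0 | _ rewrite wu≡0 = inj₁ (*-zeroʳ (A u v))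
    ... | inj₂ _ | inj₂ _ | inj₁ wv≡0 rewrite wv≡0 | *-zeroʳ (A w u) = inj₁ (*-zeroʳ (A u v))
    ... | inj₂ u≢v | inj₂ w≢u | inj₂ w≢v = inj₂ (u≢v , w≢u ∘ ≡-sym , w≢v ∘ ≡-sym)

    -- Deletion again, now of each vertex of `S` lying in a triangle inside `S`.
    triangle-bound : (S : Subset n) →
      ∣ S ∣ ≤ s + ∑[ u < n ] (χ S u * ∑[ v < n ] ∑[ w < n ] (χ S v * (χ S w * T u v w)))
    triangle-bound S = ≤-trans (∣∣≤∣zerosIn∣+sum S h)
      (+-monoˡ-≤ _ (≤s (zerosIn S h) free))
      where
      h : Fin n → ℕ
      h u = ∑[ v < n ] ∑[ w < n ] (χ S v * (χ S w * T u v w))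
      free : InducedTriangleFree G (zerosIn S h)
      free u v w u∈ v∈ w∈ uv vw uw = contradiction (begin
        1
          ≡⟨ cong₂ (λ p q → p * (q * (1 * (1 * 1)))) (proj₁ (∈-zerosIn⁻ S h v∈)) (proj₁ (∈-zerosIn⁻ S h w∈)) ⟨
        χ S v * (χ S w * (1 * (1 * 1)))
          ≡⟨ cong (λ p → χ S v * (χ S w * p)) (cong₂ _*_ (A-adj uv)
               (cong₂ _*_ (A-adj (sym G uw)) (A-adj (sym G vw)))) ⟨
        χ S v * (χ S w * T u v w)
          ≤⟨ term≤sum (λ w → χ S v * (χ S w * T u v w)) w ⟩
        ∑[ w < n ] (χ S v * (χ S w * T u v w))
          ≤⟨ term≤sum (λ v → ∑[ w < n ] (χ S v * (χ S w * T u v w))) v ⟩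
        h u
          ≡⟨ proj₂ (∈-zerosIn⁻ S h u∈) ⟩
        0 ∎) λ ()
        where open ≤-Reasoning

    -- Summing over `w` first gives `codeg u v`, at most `s`, for each ordered edge, and `degreeSum`
    -- counts the ordered edges.
    ∑T≤ : ∑[ u < n ] ∑[ v < n ] ∑[ w < n ] T u v w ≤ s * degreeSum
    ∑T≤ = begin
      ∑[ u < n ] ∑[ v < n ] ∑[ w < n ] T u v w
        ≡⟨ sum-cong-≗ (λ u → sum-cong-≗ λ v → *-distribˡ-sum (A u v) (λ w → A w u * A w v)) ⟨
      ∑[ u < n ] ∑[ v < n ] (A u v * codeg u v)
        ≤⟨ sum-mono-≤ (λ u → sum-mono-≤ λ v → codeg-bound u v) ⟩
      ∑[ u < n ] ∑[ v < n ] (A u v * s)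
        ≡⟨ ∑-comm (λ u v → A u v * s) ⟩
      ∑[ v < n ] ∑[ u < n ] (A u v * s)
        ≡⟨ sum-cong-≗ (λ v → *-distribʳ-sum s (λ u → A u v)) ⟨
      ∑[ v < n ] (deg v * s)
        ≡⟨ *-distribʳ-sum s deg ⟨
      degreeSum * s
        ≡⟨ *-comm degreeSum s ⟩
      s * degreeSum ∎
      where open ≤-Reasoning

    -- Sampling with probability `t / n` keeps 2s vertices on average, of which at most s survive
    -- deletion. So the expected triangle count, at most (t / n)³ s D, is at least s.
    degreeSum-lowerBound : .{{_ : NonZero n}} .{{_ : NonZero s}} → 2 * s ≤ n →
            -- After scaling by n³, the first cancelled term is the s granted to the surviving
            -- triangle-free set.
            n * n * n ≤ 2 * s * (2 * s) * (2 * s) * degreeSum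
    degreeSum-lowerBound t≤n = *-cancelˡ-≤ s (+-cancelˡ-≤ (s * (n * n * n)) _ _ (begin
      s * (n * n * n) + s * (n * n * n)
        ≡⟨ lemma₁ s n ⟩
      t * (n * n) * (n * 1)
        ≡⟨ cong (t * (n * n) *_) (sum-const n 1) ⟨
      t * (n * n) * ∑[ u < n ] 1
        ≤⟨ sample₃ t≤n s (λ _ → 1) T T-distinct bound ⟩
      n * n * n * s + t * t * t * ∑[ u < n ] ∑[ v < n ] ∑[ w < n ] T u v w
        ≤⟨ +-monoʳ-≤ (n * n * n * s) (*-monoʳ-≤ (t * t * t) ∑T≤) ⟩
      n * n * n * s + t * t * t * (s * degreeSum)
        ≡⟨ lemma₂ (n * n * n) s (t * t * t) degreeSum ⟩
      s * (n * n * n) + s * (t * t * t * degreeSum) ∎))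
      where
      open ≤-Reasoning
      t = 2 * s
      lemma₁ : ∀ s n → s * (n * n * n) + s * (n * n * n) ≡ 2 * s * (n * n) * (n * 1)
      lemma₁ = solve-∀
      lemma₂ : ∀ m s p d → m * s + p * (s * d) ≡ s * m + s * (p * d)
      lemma₂ = solve-∀
      bound : ∀ S → ∑[ u < n ] (χ S u * 1) ≤
                    s + ∑[ u < n ] ∑[ v < n ] ∑[ w < n ] (χ S u * (χ S v * (χ S w * T u v w)))
      bound S = begin
        ∑[ u < n ] (χ S u * 1)
          ≡⟨ sum-cong-≗ (λ u → *-identityʳ (χ S u)) ⟩
        sum (χ S)
          ≡⟨ ∣∣≡sum-χ S ⟨
        ∣ S ∣
          ≤⟨ triangle-bound S ⟩
        s + ∑[ u < n ] (χ S u * ∑[ v < n ] ∑[ w < n ] (χ S v * (χ S w * T u v w)))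
          ≡⟨ cong (s +_) (sum-cong-≗ λ u →
               trans (*-distribˡ-sum (χ S u) (λ v → ∑[ w < n ] (χ S v * (χ S w * T u v w))))
                     (sum-cong-≗ λ v → *-distribˡ-sum (χ S u) (λ w → χ S v * (χ S w * T u v w)))) ⟩
        s + ∑[ u < n ] ∑[ v < n ] ∑[ w < n ] (χ S u * (χ S v * (χ S w * T u v w))) ∎

    -- Common neighbourhoods with few edges bound the degree sum.

    -- Sampling inside U with probability a / b.
    sample-independent : ∀ {a b} .{{_ : NonZero b}} → a ≤ b → (U : Subset n) →
      a * b * sum (χ U) ≤ b * b * s + a * a * ∑[ u < n ] ∑[ v < n ] (χ U u * χ U v * A u v)
    sample-independent a≤b U = sample₂ a≤b s (χ U) g off bound
      where
      open ≤-Reasoning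
      g : Fin n → Fin n → ℕ
      g u v = χ U u * χ U v * A u v
      off : ∀ u v → g u v ≡ 0 ⊎ u ≢ v
      off u v with A-distinct u v
      ... | inj₁ uv≡0 rewrite uv≡0 = inj₁ (*-zeroʳ (χ U u * χ U v))
      ... | inj₂ u≢v = inj₂ u≢v
      lemma : ∀ p q r s a → p * q * (r * s * a) ≡ p * (r * (q * s * a))
      lemma = solve-∀
      bound : ∀ S → ∑[ u < n ] (χ S u * χ U u) ≤
                    s + ∑[ u < n ] ∑[ v < n ] (χ S u * (χ S v * g u v))
      bound S = begin
        ∑[ u < n ] (χ S u * χ U u)
          -- Sampling in `U` is intersecting `U` with a random `S` from all vertices; the indicators
          -- of `U` become coefficients.
          ≡⟨ sum-cong-≗ (χ-∩ S U) ⟨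
        sum (χ (S ∩ U))
          ≡⟨ ∣∣≡sum-χ (S ∩ U) ⟨
        ∣ S ∩ U ∣
          ≤⟨ independent-bound (S ∩ U) ⟩
        s + ∑[ u < n ] (χ (S ∩ U) u * ∑[ v < n ] (χ (S ∩ U) v * A u v))
          ≡⟨ cong (s +_) (sum-cong-≗ λ u →
               trans (*-distribˡ-sum (χ (S ∩ U) u) (λ v → χ (S ∩ U) v * A u v))
                     (sum-cong-≗ λ v → trans
                       (cong₂ (λ p q → p * (q * A u v)) (χ-∩ S U u) (χ-∩ S U v))
                       (lemma (χ S u) (χ U u) (χ S v) (χ U v) (A u v)))) ⟩
        s + ∑[ u < n ] ∑[ v < n ] (χ S u * (χ S v * g u v)) ∎

    -- Only edges contribute, and there both codegrees are at most `s`; the single factor `A u v`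
    -- serves `codeg-bound` twice.
    ∑A*codeg²≤ : ∑[ u < n ] ∑[ v < n ] (codeg u v * codeg u v * A u v) ≤ s * s * degreeSum
    ∑A*codeg²≤ = begin
      ∑[ u < n ] ∑[ v < n ] (codeg u v * codeg u v * A u v)
        ≤⟨ sum-mono-≤ (λ u → sum-mono-≤ λ v → entry u v) ⟩
      ∑[ u < n ] ∑[ v < n ] (s * s * A u v)
        ≡⟨ ∑-comm (λ u v → s * s * A u v) ⟩
      ∑[ v < n ] ∑[ u < n ] (s * s * A u v)
        ≡⟨ sum-cong-≗ (λ v → *-distribˡ-sum (s * s) (λ u → A u v)) ⟨
      ∑[ v < n ] (s * s * deg v)
        ≡⟨ *-distribˡ-sum (s * s) deg ⟨
      s * s * degreeSum ∎
      where
      open ≤-Reasoning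
      lemma₁ : ∀ c a → c * c * a ≡ c * (a * c)
      lemma₁ = solve-∀
      lemma₂ : ∀ c a s → c * (a * s) ≡ s * (a * c)
      lemma₂ = solve-∀
      lemma₃ : ∀ a s → s * (a * s) ≡ s * s * a
      lemma₃ = solve-∀
      entry : ∀ u v → codeg u v * codeg u v * A u v ≤ s * s * A u v
      entry u v = begin
        codeg u v * codeg u v * A u v    ≡⟨ lemma₁ (codeg u v) (A u v) ⟩
        codeg u v * (A u v * codeg u v)  ≤⟨ *-monoʳ-≤ (codeg u v) (codeg-bound u v) ⟩
        codeg u v * (A u v * s)          ≡⟨ lemma₂ (codeg u v) (A u v) s ⟩
        s * (A u v * codeg u v)          ≤⟨ *-monoʳ-≤ s (codeg-bound u v) ⟩
        s * (A u v * s)                  ≡⟨ lemma₃ (A u v) s ⟩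
        s * s * A u v                    ∎

    -- Dependent random choice: sampling inside the common neighbourhood of a
    -- pair x , y, averaged over all pairs. A vertex u lies in (deg u)² of these
    -- neighbourhoods, an edge u v in only (codeg u v)² ≤ s².
    sample-commonNeighbours : ∀ {a b} .{{_ : NonZero b}} → a ≤ b →
      a * b * ∑[ u < n ] (deg u * deg u) ≤ n * n * (b * b * s) + a * a * (s * s * degreeSum)
    sample-commonNeighbours {a} {b} a≤b = begin
      a * b * ∑[ u < n ] (deg u * deg u)
        ≡⟨ cong (a * b *_) left ⟨
      a * b * ∑[ x < n ] ∑[ y < n ] sum (χ (N x y))
        ≡⟨ pull (a * b) (λ x y → sum (χ (N x y))) ⟩
      ∑[ x < n ] ∑[ y < n ] (a * b * sum (χ (N x y)))
        ≤⟨ sum-mono-≤ (λ x → sum-mono-≤ λ y → sample-independent a≤b (N x y)) ⟩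
      ∑[ x < n ] ∑[ y < n ] (b * b * s + a * a * e x y)
        ≡⟨ sum-cong-≗ (λ x → ∑-distrib-+ (λ _ → b * b * s) (λ y → a * a * e x y)) ⟩
      ∑[ x < n ] (∑[ y < n ] (b * b * s) + ∑[ y < n ] (a * a * e x y))
        ≡⟨ ∑-distrib-+ (λ _ → ∑[ y < n ] (b * b * s)) (λ x → ∑[ y < n ] (a * a * e x y)) ⟩
      ∑[ x < n ] ∑[ y < n ] (b * b * s) + ∑[ x < n ] ∑[ y < n ] (a * a * e x y)
        ≡⟨ cong₂ _+_ consts (≡-sym (pull (a * a) e)) ⟩
      n * n * (b * b * s) + a * a * ∑[ x < n ] ∑[ y < n ] e x y
        ≡⟨ cong (λ p → n * n * (b * b * s) + a * a * p) right ⟩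
      n * n * (b * b * s) + a * a * ∑[ u < n ] ∑[ v < n ] (codeg u v * codeg u v * A u v)
        ≤⟨ +-monoʳ-≤ (n * n * (b * b * s)) (*-monoʳ-≤ (a * a) ∑A*codeg²≤) ⟩
      n * n * (b * b * s) + a * a * (s * s * degreeSum) ∎
      where
      open ≤-Reasoning
      -- Here `x` and `y` are the first arguments of `adj?`, unlike in `commonNeighbours`, so that
      -- summing over them produces `deg u` and `codeg u v` directly.
      N : Fin n → Fin n → Subset n
      N x y = tabulate λ u → does (adj? G x u) ∧ does (adj? G y u)
      χ-N : ∀ x y u → χ (N x y) u ≡ A x u * A y u
      χ-N x y u = trans (χ-tabulate _ u) (⟦∧⟧ (does (adj? G x u)) _)
      e : Fin n → Fin n → ℕ
      e x y = ∑[ u < n ] ∑[ v < n ] (χ (N x y) u * χ (N x y) v * A u v)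
      pull : ∀ k (f : Fin n → Fin n → ℕ) →
             k * ∑[ x < n ] ∑[ y < n ] f x y ≡ ∑[ x < n ] ∑[ y < n ] (k * f x y)
      pull k f = trans (*-distribˡ-sum k (λ x → sum (f x))) (sum-cong-≗ λ x → *-distribˡ-sum k (f x))
      consts : ∑[ x < n ] ∑[ y < n ] (b * b * s) ≡ n * n * (b * b * s)
      consts = trans (sum-cong-≗ {n} λ _ → sum-const n (b * b * s))
              (trans (sum-const n _) (≡-sym (*-assoc n n _)))
      left : ∑[ x < n ] ∑[ y < n ] sum (χ (N x y)) ≡ ∑[ u < n ] (deg u * deg u)
      left = trans
        (sum-cong-≗ λ x → sum-cong-≗ λ y → sum-cong-≗ (χ-N x y))
        (trans (∑-rotate λ x y u → A x u * A y u)
               (sum-cong-≗ λ u → sum-*-sum (λ x → A x u) (λ y → A y u)))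
      lemma : ∀ p q r s k → p * q * (r * s) * k ≡ k * (p * r * (q * s))
      lemma = solve-∀
      -- Collecting the factors in `x` and those in `y` splits the sum over pairs into a product of
      -- two equal sums.
      inner : ∀ u v → ∑[ x < n ] ∑[ y < n ] (χ (N x y) u * χ (N x y) v * A u v) ≡
                      codeg u v * codeg u v * A u v
      inner u v = begin-equality
        ∑[ x < n ] ∑[ y < n ] (χ (N x y) u * χ (N x y) v * A u v)
          ≡⟨ sum-cong-≗ (λ x → sum-cong-≗ λ y → trans
               (cong₂ (λ p q → p * q * A u v) (χ-N x y u) (χ-N x y v))
               (lemma (A x u) (A y u) (A x v) (A y v) (A u v))) ⟩
        ∑[ x < n ] ∑[ y < n ] (A u v * (A x u * A x v * (A y u * A y v)))
          ≡⟨ pull (A u v) (λ x y → A x u * A x v * (A y u * A y v)) ⟨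
        A u v * ∑[ x < n ] ∑[ y < n ] (A x u * A x v * (A y u * A y v))
          ≡⟨ cong (A u v *_) (sum-*-sum (λ x → A x u * A x v) (λ y → A y u * A y v)) ⟩
        A u v * (codeg u v * codeg u v)
          ≡⟨ *-comm (A u v) _ ⟩
        codeg u v * codeg u v * A u v ∎
      right : ∑[ x < n ] ∑[ y < n ] e x y ≡
              ∑[ u < n ] ∑[ v < n ] (codeg u v * codeg u v * A u v)
      right = trans
        (∑-rotate λ x y u → ∑[ v < n ] (χ (N x y) u * χ (N x y) v * A u v))
        (sum-cong-≗ λ u → trans
          (∑-rotate λ x y v → χ (N x y) u * χ (N x y) v * A u v)
          (sum-cong-≗ (inner u)))

    -- By Cauchy-Schwarz a random pair has on average at least D² / n³ common neighbours, so the
    -- probability a / b = 2sn³ / D² keeps at least 2s of them. The hypothesis says that this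
    -- probability is at most 1.
    degreeSum-upperBound : .{{_ : NonZero n}} .{{_ : NonZero s}} .{{_ : NonZero degreeSum}} →
      2 * s * (n * n * n) ≤ degreeSum * degreeSum →
      degreeSum * degreeSum * degreeSum ≤ 2 * s * (2 * s) * (2 * s) * (n * n * (n * n))
    -- `K` is the common factor once denominators are cleared; the cancelled `K * (D * D * D)`
    -- equals `n * (n * n * (b * b * s))`, the share of the independent sets.
    degreeSum-upperBound a≤b = *-cancelˡ-≤ K (+-cancelˡ-≤ (K * (D * D * D)) _ _ (begin
      K * (D * D * D) + K * (D * D * D)
        ≡⟨ lemma₁ s n D ⟩
      a * b * (D * D)
        ≤⟨ *-monoʳ-≤ (a * b) (cauchy-schwarz deg) ⟩
      a * b * (n * ∑[ u < n ] (deg u * deg u))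
        ≡⟨ x∙yz≈y∙xz (a * b) n _ ⟩
      n * (a * b * ∑[ u < n ] (deg u * deg u))
        ≤⟨ *-monoʳ-≤ n (sample-commonNeighbours a≤b) ⟩
      n * (n * n * (b * b * s) + a * a * (s * s * D))
        -- The estimate yields 4s³n⁴; padding it to 8s³n⁴ leaves a bound in 2s alone.
        ≤⟨ m≤m+n _ (K * (4 * (s * s * s) * (n * n * (n * n)))) ⟩
      n * (n * n * (b * b * s) + a * a * (s * s * D)) + K * (4 * (s * s * s) * (n * n * (n * n)))
        ≡⟨ lemma₂ s n D ⟩
      K * (D * D * D) + K * (2 * s * (2 * s) * (2 * s) * (n * n * (n * n))) ∎))
      where
      open ≤-Reasoning
      open import Algebra.Properties.CommutativeSemigroup *-commutativeSemigroup
      D = degreeSum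
      a = 2 * s * (n * n * n)
      b = D * D
      K = s * (n * n * n) * D
      instance
        b≢0 : NonZero b
        b≢0 = m*n≢0 D D
        nnn≢0 : NonZero (n * n * n)
        nnn≢0 = m*n≢0 (n * n) n {{m*n≢0 n n}}
        K≢0 : NonZero K
        K≢0 = m*n≢0 (s * (n * n * n)) D {{m*n≢0 s (n * n * n)}}
      lemma₁ : ∀ s n D → s * (n * n * n) * D * (D * D * D) + s * (n * n * n) * D * (D * D * D) ≡
                         2 * s * (n * n * n) * (D * D) * (D * D)
      lemma₁ = solve-∀
      lemma₂ : ∀ s n D →
        n * (n * n * (D * D * (D * D) * s) + 2 * s * (n * n * n) * (2 * s * (n * n * n)) * (s * s * D))
          + s * (n * n * n) * D * (4 * (s * s * s) * (n * n * (n * n))) ≡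
        s * (n * n * n) * D * (D * D * D)
          + s * (n * n * n) * D * (2 * s * (2 * s) * (2 * s) * (n * n * (n * n)))
      lemma₂ = solve-∀

-- Comparison of exponents.

^-cancelˡ-≤ : ∀ k {x y} → x ^ suc k ≤ y ^ suc k → x ≤ y
^-cancelˡ-≤ k x^k≤y^k = ≮⇒≥ λ y<x → <⇒≱ (^-monoˡ-< (suc k) y<x) x^k≤y^k

-- The two bounds on the degree sum D are incompatible; t stands for 2s.
module DensityConflict (n t D : ℕ) .{{_ : NonZero n}} .{{_ : NonZero t}} (t¹²<n⁵ : t ^ 12 < n ^ 5) where

  open ≤-Reasoning
  open +-*-Solver

  -- Makes t / n a probability for the first sampling.
  t≤n : t ≤ n
  -- The argument 4 stands for exponent 5: fifth roots are taken.
  t≤n = ^-cancelˡ-≤ 4 (begin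
    t ^ 5   ≤⟨ ^-monoʳ-≤ t (m≤m+n 5 7) ⟩
    t ^ 12  <⟨ t¹²<n⁵ ⟩
    n ^ 5   ∎)

  -- There is room because 7/3 < 12/5, which becomes 35 < 36 after raising to the fifth power.
  t⁷≤n³ : t ^ 7 ≤ n ^ 3
  t⁷≤n³ = ^-cancelˡ-≤ 4 (begin
    (t ^ 7) ^ 5   ≡⟨ ^-*-assoc t 7 5 ⟩
    t ^ 35        ≤⟨ ^-monoʳ-≤ t (n≤1+n 35) ⟩
    t ^ 36        ≡⟨ ^-*-assoc t 12 3 ⟨
    (t ^ 12) ^ 3  ≤⟨ ^-monoˡ-≤ 3 (<⇒≤ t¹²<n⁵) ⟩
    (n ^ 5) ^ 3   ≡⟨ ^-*-assoc n 5 3 ⟩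
    n ^ 15        ≡⟨ ^-*-assoc n 3 5 ⟨
    (n ^ 3) ^ 5   ∎)

  module _ (n³≤t³D : n * n * n ≤ t * t * t * D) where

    D≢0 : NonZero D
    D≢0 = m*n≢0⇒n≢0 (t * t * t) {{>-nonZero (<-≤-trans
      (>-nonZero⁻¹ (n * n * n) {{m*n≢0 (n * n) n {{m*n≢0 n n}}}}) n³≤t³D)}}

    -- Makes tn³ / D² a probability for the second sampling. Squaring D ≥ n³ / t³ gives D² ≥ n⁶ /
    -- t⁶, which is at least tn³ exactly when t⁷ ≤ n³.
    tn³≤D² : t * (n * n * n) ≤ D * D
    tn³≤D² = *-cancelˡ-≤ (t ^ 6) {{m^n≢0 t 6}} (begin
      t ^ 6 * (t * (n * n * n))        ≡⟨ lemma₁ t (n * n * n) ⟩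
      t ^ 7 * (n * n * n)              ≤⟨ *-monoˡ-≤ (n * n * n) t⁷≤n³ ⟩
      n ^ 3 * (n * n * n)              ≡⟨ cong (_* (n * n * n)) (lemma₂ n) ⟩
      n * n * n * (n * n * n)          ≤⟨ *-mono-≤ n³≤t³D n³≤t³D ⟩
      t * t * t * D * (t * t * t * D)  ≡⟨ lemma₃ t D ⟩
      t ^ 6 * (D * D)                  ∎)
      where
      lemma₁ : ∀ t m → t ^ 6 * (t * m) ≡ t ^ 7 * m
      lemma₁ = solve 2 (λ t m → t :^ 6 :* (t :* m) := t :^ 7 :* m) refl
      lemma₂ : ∀ n → n ^ 3 ≡ n * n * n
      lemma₂ = solve 1 (λ n → n :^ 3 := n :* n :* n) refl
      lemma₃ : ∀ t D → t * t * t * D * (t * t * t * D) ≡ t ^ 6 * (D * D)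
      lemma₃ = solve 2 (λ t D → t :* t :* t :* D :* (t :* t :* t :* D) := t :^ 6 :* (D :* D)) refl

    -- Cubing the lower bound would give n⁹ ≤ t⁹D³ ≤ t¹²n⁴, hence n⁵ ≤ t¹².
    D³≰t³n⁴ : ¬ D * D * D ≤ t * t * t * (n * n * (n * n))
    D³≰t³n⁴ D³≤t³n⁴ = <⇒≱ t¹²<n⁵ (*-cancelˡ-≤ (n ^ 4) {{m^n≢0 n 4}} (begin
      n ^ 4 * n ^ 5
        ≡⟨ lemma₁ n ⟩
      n * n * n * (n * n * n) * (n * n * n)
        ≤⟨ *-mono-≤ (*-mono-≤ n³≤t³D n³≤t³D) n³≤t³D ⟩
      t * t * t * D * (t * t * t * D) * (t * t * t * D)
        ≡⟨ lemma₂ t D ⟩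
      t ^ 9 * (D * D * D)
        ≤⟨ *-monoʳ-≤ (t ^ 9) D³≤t³n⁴ ⟩
      t ^ 9 * (t * t * t * (n * n * (n * n)))
        ≡⟨ lemma₃ t n ⟩
      n ^ 4 * t ^ 12 ∎))
      where
      lemma₁ : ∀ n → n ^ 4 * n ^ 5 ≡ n * n * n * (n * n * n) * (n * n * n)
      lemma₁ = solve 1 (λ n → n :^ 4 :* n :^ 5 := n :* n :* n :* (n :* n :* n) :* (n :* n :* n)) refl
      lemma₂ : ∀ t D → t * t * t * D * (t * t * t * D) * (t * t * t * D) ≡ t ^ 9 * (D * D * D)
      lemma₂ = solve 2 (λ t D → t :* t :* t :* D :* (t :* t :* t :* D) :* (t :* t :* t :* D) := t :^ 9 :* (D :* D :* D)) refl
      lemma₃ : ∀ t n → t ^ 9 * (t * t * t * (n * n * (n * n))) ≡ n ^ 4 * t ^ 12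
      lemma₃ = solve 2 (λ t n → t :^ 9 :* (t :* t :* t :* (n :* n :* (n :* n))) := n :^ 4 :* t :^ 12) refl

-- Existence of a large triangle-free set.

module _ {n : ℕ} .{{_ : NonZero n}} (G : Graph n) (K5free : K5Free G) where

  -- `t≤n` permits the first sampling; its lower bound on the degree sum permits the second, whose
  -- upper bound is then refuted.
  triangleFree-unbounded : ∀ s → .{{_ : NonZero s}} → (2 * s) ^ 12 < n ^ 5 →
    ¬ (∀ S → InducedTriangleFree G S → ∣ S ∣ ≤ s)
  triangleFree-unbounded s t¹²<n⁵ ≤s =
    D³≰t³n⁴ n³≤t³D (degreeSum-upperBound G K5free ≤s (tn³≤D² n³≤t³D))
    where
    instance
      t≢0 : NonZero (2 * s)
      t≢0 = m*n≢0 2 s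
    open DensityConflict n (2 * s) (degreeSum G) t¹²<n⁵
    n³≤t³D : n * n * n ≤ 2 * s * (2 * s) * (2 * s) * degreeSum G
    n³≤t³D = degreeSum-lowerBound G K5free ≤s t≤n
    instance
      degreeSum≢0 : NonZero (degreeSum G)
      degreeSum≢0 = D≢0 n³≤t³D

  ⁅⁆-triangleFree : ∀ x → InducedTriangleFree G ⁅ x ⁆
  ⁅⁆-triangleFree x u v w u∈ v∈ _ uv _ _
    with refl ← x∈⁅y⁆⇒x≡y x u∈ | refl ← x∈⁅y⁆⇒x≡y x v∈ = irrefl G uv

  -- Descent on a bound `k` for all triangle-free sets. Either `triangleFree-unbounded` applies to
  -- `k`, or a set of exactly `k` vertices would already be large, so the bound drops by one. It
  -- cannot reach 0, since the singleton of the given vertex is triangle-free.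
  ¬all-small : Fin n → ∀ k → (∀ S → InducedTriangleFree G S → ∣ S ∣ ≤ k) →
               ¬ (∀ S → InducedTriangleFree G S → (2 * ∣ S ∣) ^ 12 < n ^ 5)
  ¬all-small x zero    ≤k small with () ← subst (_≤ 0) (∣⁅x⁆∣≡1 x) (≤k ⁅ x ⁆ (⁅⁆-triangleFree x))
  ¬all-small x (suc k) ≤k small with (2 * suc k) ^ 12 <? n ^ 5
  ... | yes t¹²<n⁵ = triangleFree-unbounded (suc k) t¹²<n⁵ ≤k
  ... | no  t¹²≮n⁵ = ¬all-small x k
    (λ S free → m<1+n⇒m≤n (≤∧≢⇒< (≤k S free) λ ∣S∣≡1+k →
      t¹²≮n⁵ (subst (λ m → (2 * m) ^ 12 < n ^ 5) ∣S∣≡1+k (small S free))))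
    small

theorem9p2 : (n : ℕ) (G : Graph n) → K5Free G →
    ∃ λ (S : Subset n) → InducedTriangleFree G S × n ^ 5 ≤ (2 * ∣ S ∣) ^ 12
-- Without vertices the descent has no singleton to end on, but `0 ^ 5` is 0 and the empty set
-- serves.
theorem9p2 zero      G K5free = [] , (λ ()) , z≤n
theorem9p2 n@(suc _) G K5free
  -- Exhaustive search makes the argument constructive; a failed search says that every
  -- triangle-free set is small, and the descent then starts from the trivial bound `n`.
  with anySubset? (λ S → triangleFree? G S ×-dec (n ^ 5 ≤? (2 * ∣ S ∣) ^ 12))
... | yes found = found
... | no  none  = ⊥-elim (¬all-small G K5free zero n (λ S _ → ∣p∣≤n S)
                    λ S free → ≰⇒> λ n⁵≤ → none (S , free , n⁵≤))
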